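{- The logic $\mathsf{GS4}$ has the finite model property: for every formula $\varphi$, if $\mathsf{GS4}\nvdash\varphi$, then there is a $\mathsf{GS4}$-model $\mathcal M$ with finitely many worlds such that $\mathcal M\not\models\varphi$.
   Context: Fix a countably infinite set $\mathbb P$ of propositional variables. Formulas: $\varphi,\psi ::= p\mid\bot\mid(\varphi\wedge\psi)\mid(\varphi\vee\psi)\mid(\varphi\to\psi)\mid\Diamond\varphi\mid\Box\varphi$; $\neg\varphi:=\varphi\to\bot$. A bi-intuitionistic frame is $(W,W_\bot,\preccurlyeq,\sqsubseteq)$ with $\preccurlyeq,\sqsubseteq$ preorders on $W$ and $W_\bot\subseteq W$ upward closed under both; infallible if $W_\bot=\varnothing$. A valuation $V:\mathbb P\to 2^W$ has each $V(p)$ upward closed under $\preccurlyeq$ and containing $W_\bot$; a model is $\mathcal M=(W,W_\bot,\preccurlyeq,\sqsubseteq,V)$. Satisfaction: $p$ iff $w\in V(p)$; $\bot$ iff $w\in W_\bot$; $\wedge,\vee$ pointwise; $w\models\varphi\to\psi$ iff for all $v\succcurlyeq w$, $v\models\varphi$ implies $v\models\psi$; $w\models\Diamond\varphi$ iff for all $u\succcurlyeq w$ there is $v\sqsupseteq u$ with $v\models\varphi$; $w\models\Box\varphi$ iff $v\models\varphi$ whenever $w\preccurlyeq u\sqsubseteq v$. $\mathcal M\models\varphi$ iff $\varphi$ holds at every $w\in W\setminus W_\bot$. $\sqsubseteq$ is forward confluent if $w\preccurlyeq w'$ and $w\sqsubseteq v$ imply some $v'$ with $v\preccurlyeq v'$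 and $w'\sqsubseteq v'$; backward confluent if $w\sqsubseteq v\preccurlyeq v'$ implies some $w'$ with $w\preccurlyeq w'\sqsubseteq v'$. The frame is locally linear if $w\preccurlyeq u$ and $w\preccurlyeq v$ imply $u\preccurlyeq v$ or $v\preccurlyeq u$. A $\mathsf{GS4}$-frame is an infallible, locally linear bi-intuitionistic frame in which $\sqsubseteq$ is forward and backward confluent; a $\mathsf{GS4}$-model is a model on such a frame. $\mathsf{CS4}$ is the least set of formulas containing all intuitionistic propositional tautologies and all instances of $\Box(\varphi\to\psi)\to(\Box\varphi\to\Box\psi)$, $\Box(\varphi\to\psi)\to(\Diamond\varphi\to\Diamond\psi)$, $\Box\varphi\to\varphi$, $\varphi\to\Diamond\varphi$, $\Box\varphi\to\Box\Box\varphi$, $\Diamond\Diamond\varphi\to\Diamond\varphi$, closed under modus ponens and necessitation. $\mathsf{GS4}$ is $\mathsf{CS4}$ extended with all instances of $(\Diamond\varphi\to\Box\psi)\to\Box(\varphi\to\psi)$, $\Diamond(\varphi\vee\psi)\to\Diamond\varphi\vee\Diamond\psi$, $\neg\Diamond\bot$, and $(\varphi\to\psi)\vee(\psi\to\varphi)$ (closed under the same rules). -}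

module Defs where

open import Data.Fin.Base using (Fin)
open import Data.List.Base using (List; []; _∷_)
open import Data.List.Membership.Propositional using () renaming (_∈_ to _∈ˡ_)
open import Data.Nat.Base using (ℕ)
open import Data.Product.Base using (∃-syntax; _×_)
open import Data.Sum.Base using (_⊎_)
open import Function.Bundles using (_↔_)
open import Level using (0ℓ)
open import Relation.Binary.Core using (Rel)
open import Relation.Binary.PropositionalEquality.Core using (_≡_)
open import Relation.Binary.Structures using (IsPreorder)
open import Relation.Nullary.Negation.Core using (¬_)
open import Relation.Unary using (Pred; Empty; _∈_; _∉_; _⊆_)

infix  9 ◇_ □_ ~_
infixr 7 _∧_
infixr 6 _∨_
infixr 5 _⇒_
infix  3 _⊢ᴵ_

data Form : Set where
  var           : ℕ → Form
  bot           : Form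
  _∧_ _∨_ _⇒_   : Form → Form → Form
  ◇_ □_         : Form → Form

~_ : Form → Form
~ φ = φ ⇒ bot

-- Natural deduction for intuitionistic propositional logic. No rule inspects
-- ◇ or □, so modal formulas behave as atoms: [] ⊢ᴵ φ says that φ is a
-- substitution instance of an intuitionistic propositional tautology.
data _⊢ᴵ_ : List Form → Form → Set where
  hyp  : ∀ {Γ φ}     → φ ∈ˡ Γ → Γ ⊢ᴵ φ
  botE : ∀ {Γ φ}     → Γ ⊢ᴵ bot → Γ ⊢ᴵ φ
  ∧I   : ∀ {Γ φ ψ}   → Γ ⊢ᴵ φ → Γ ⊢ᴵ ψ → Γ ⊢ᴵ φ ∧ ψ
  ∧E₁  : ∀ {Γ φ ψ}   → Γ ⊢ᴵ φ ∧ ψ → Γ ⊢ᴵ φ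
  ∧E₂  : ∀ {Γ φ ψ}   → Γ ⊢ᴵ φ ∧ ψ → Γ ⊢ᴵ ψ
  ∨I₁  : ∀ {Γ φ ψ}   → Γ ⊢ᴵ φ → Γ ⊢ᴵ φ ∨ ψ
  ∨I₂  : ∀ {Γ φ ψ}   → Γ ⊢ᴵ ψ → Γ ⊢ᴵ φ ∨ ψ
  ∨E   : ∀ {Γ φ ψ χ} → Γ ⊢ᴵ φ ∨ ψ → φ ∷ Γ ⊢ᴵ χ → ψ ∷ Γ ⊢ᴵ χ → Γ ⊢ᴵ χ
  ⇒I   : ∀ {Γ φ ψ}   → φ ∷ Γ ⊢ᴵ ψ → Γ ⊢ᴵ φ ⇒ ψ
  ⇒E   : ∀ {Γ φ ψ}   → Γ ⊢ᴵ φ ⇒ ψ → Γ ⊢ᴵ φ → Γ ⊢ᴵ ψ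

IntTautology : Pred Form 0ℓ
IntTautology φ = [] ⊢ᴵ φ

data CS4-Extension (Ax : Pred Form 0ℓ) : Pred Form 0ℓ where
  taut  : ∀ {φ} → IntTautology φ → CS4-Extension Ax φ
  K□    : ∀ φ ψ → CS4-Extension Ax (□ (φ ⇒ ψ) ⇒ (□ φ ⇒ □ ψ))
  K◇    : ∀ φ ψ → CS4-Extension Ax (□ (φ ⇒ ψ) ⇒ (◇ φ ⇒ ◇ ψ))
  T□    : ∀ φ   → CS4-Extension Ax (□ φ ⇒ φ)
  T◇    : ∀ φ   → CS4-Extension Ax (φ ⇒ ◇ φ)
  4□    : ∀ φ   → CS4-Extension Ax (□ φ ⇒ □ □ φ)
  4◇    : ∀ φ   → CS4-Extension Ax (◇ ◇ φ ⇒ ◇ φ)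
  extra : ∀ {φ} → Ax φ → CS4-Extension Ax φ
  MP    : ∀ {φ ψ} → CS4-Extension Ax (φ ⇒ ψ) → CS4-Extension Ax φ → CS4-Extension Ax ψ
  Nec   : ∀ {φ} → CS4-Extension Ax φ → CS4-Extension Ax (□ φ)

data GS4-Axiom : Pred Form 0ℓ where
  FS : ∀ φ ψ → GS4-Axiom ((◇ φ ⇒ □ ψ) ⇒ □ (φ ⇒ ψ))
  DP : ∀ φ ψ → GS4-Axiom (◇ (φ ∨ ψ) ⇒ (◇ φ ∨ ◇ ψ))
  N  : GS4-Axiom (~ (◇ bot))
  GD : ∀ φ ψ → GS4-Axiom ((φ ⇒ ψ) ∨ (ψ ⇒ φ))

GS4⊢_ : Pred Form 0ℓ
GS4⊢_ = CS4-Extension GS4-Axiom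

UpClosed : {W : Set} → Rel W 0ℓ → Pred W 0ℓ → Set
UpClosed _≤_ X = ∀ {w v} → w ≤ v → w ∈ X → v ∈ X

record BiIntFrame : Set₁ where
  infix 4 _≼_ _⊑_
  field
    W            : Set
    W⊥           : Pred W 0ℓ
    _≼_ _⊑_      : Rel W 0ℓ
    ≼-isPreorder : IsPreorder _≡_ _≼_
    ⊑-isPreorder : IsPreorder _≡_ _⊑_
    W⊥-≼-closed  : UpClosed _≼_ W⊥
    W⊥-⊑-closed  : UpClosed _⊑_ W⊥

module _ (F : BiIntFrame) where
  open BiIntFrame F

  Infallible : Set
  Infallible = Empty W⊥

  ForwardConfluent : Set
  ForwardConfluent = ∀ {w w′ v} → w ≼ w′ → w ⊑ v → ∃[ v′ ] (v ≼ v′ × w′ ⊑ v′)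

  BackwardConfluent : Set
  BackwardConfluent = ∀ {w v v′} → w ⊑ v → v ≼ v′ → ∃[ w′ ] (w ≼ w′ × w′ ⊑ v′)

  LocallyLinear : Set
  LocallyLinear = ∀ {w u v} → w ≼ u → w ≼ v → u ≼ v ⊎ v ≼ u

  record IsGS4Frame : Set where
    field
      infallible        : Infallible
      locallyLinear     : LocallyLinear
      forwardConfluent  : ForwardConfluent
      backwardConfluent : BackwardConfluent

record Model : Set₁ where
  field
    frame : BiIntFrame
  open BiIntFrame frame public
  field
    V          : ℕ → Pred W 0ℓ
    V-≼-closed : ∀ p → UpClosed _≼_ (V p)
    W⊥⊆V       : ∀ p → W⊥ ⊆ V p

IsGS4Model : Model → Set
IsGS4Model M = IsGS4Frame (Model.frame M)

FinitelyManyWorlds : Model → Set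
FinitelyManyWorlds M = ∃[ n ] (Model.W M ↔ Fin n)

infix 3 _,_⊨_ _⊨_ _⊭_

_,_⊨_ : (M : Model) → Model.W M → Form → Set
M , w ⊨ var p   = w ∈ Model.V M p
M , w ⊨ bot     = w ∈ Model.W⊥ M
M , w ⊨ φ ∧ ψ   = (M , w ⊨ φ) × (M , w ⊨ ψ)
M , w ⊨ φ ∨ ψ   = (M , w ⊨ φ) ⊎ (M , w ⊨ ψ)
M , w ⊨ φ ⇒ ψ   = let open Model M in ∀ v → w ≼ v → M , v ⊨ φ → M , v ⊨ ψ
M , w ⊨ ◇ φ     = let open Model M in ∀ u → w ≼ u → ∃[ v ] (u ⊑ v × (M , v ⊨ φ))
M , w ⊨ □ φ     = let open Model M in ∀ u v → w ≼ u → u ⊑ v → M , v ⊨ φ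

_⊨_ : Model → Form → Set
M ⊨ φ = ∀ w → w ∉ Model.W⊥ M → M , w ⊨ φ

_⊭_ : Model → Form → Set
M ⊭ φ = ¬ (M ⊨ φ)

{-# OPTIONS --safe #-}

-- Let Σ be the set of subformulas of φ together with ⊤ and ⊥. By the axiom GD,
-- a prime theory Γ preorders Σ linearly by a ≤ b iff (a ⇒ b) ∈ Γ, and the
-- traces on Σ of the prime theories above Γ are exactly the proper up-sets of
-- this preorder that contain ⊤. So the finite table of this preorder, the code
-- of Γ, determines the intuitionistic behaviour of Γ on Σ. Passing to codes,
-- with cuts as ≼ and the transitive closure of the image of the canonical
-- relation as ⊑, preserves both confluence properties (cuts lift to extensions
-- of any prime theory with the given code) and truth on Σ.
--
-- Constructively, prime theories exist outright as negatively defined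
-- predicates, but which codes are realised is only decided up to double
-- negation. Since the resulting Boolean tables range over a finite set and being
-- a countermodel is decidable for them, an exhaustive search finds one.
module Submission where

open import Data.Empty using (⊥; ⊥-elim)
open import Data.Fin.Base using (Fin; zero; suc; toℕ; combine; remQuot; funToFin; finToFun)
open import Data.Fin.Patterns
open import Data.Fin.Properties using (toℕ-injective; toℕ<n; finToFun-funToFin; any?; all?; _≟_; remQuot-combine)
open import Data.List.Base using (List; []; _∷_; _++_; lookup)
open import Data.List.Membership.Propositional using (_∈_)
open import Data.List.Membership.Propositional.Properties using (∈-++⁺ˡ; ∈-++⁺ʳ; ∈-++⁻; ∈-lookup)
open import Data.List.Properties using (∷-injectiveˡ)
open import Data.List.Relation.Unary.All using (All; []; _∷_)
open import Data.List.Relation.Unary.Any using (here; there; index)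
open import Data.List.Relation.Unary.Any.Properties using (lookup-index)
open import Data.Nat.Base using (ℕ; zero; suc; _+_; _*_; _^_; _⊔_; _≤′_; ≤′-reflexive; ≤′-step)
open import Data.Nat.DivMod using (_%_; [m+kn]%n≡m%n; m<n⇒m%n≡m)
open import Data.Nat.Properties using (suc-injective; +-cancelˡ-≡; *-cancelʳ-≡; ≤⇒≤′; m≤m⊔n; m≤n⊔m) renaming (_≟_ to _≟ᴺ_)
open import Data.Product.Base using (∃-syntax; _×_; _,_; proj₁; proj₂; Σ-syntax; uncurry)
open import Data.Sum.Base using (_⊎_; inj₁; inj₂; [_,_]′)
open import Function.Base using (_∘_; id; case_of_)
open import Function.Construct.Identity using (↔-id)
open import Relation.Binary.Construct.Closure.ReflexiveTransitive using (Star; ε; _◅_; _◅◅_)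
open import Relation.Binary.Definitions using (DecidableEquality)
open import Relation.Binary.PropositionalEquality using (_≡_; refl; sym; trans; cong; cong₂; subst; isEquivalence)
open import Relation.Nullary.Decidable using (Dec; yes; no; map′; _×-dec_; _⊎-dec_; _→-dec_; ¬?; decidable-stable; ¬¬-excluded-middle)
open import Relation.Nullary.Negation.Core using (¬_)
open import Defs hiding (_⊨_)

-- Injective numbering of formulas

-- Reverse Polish notation written in front of `r`; `var n` becomes `0F` followed by `n` copies of
-- `1F`.
tokens : Form → List (Fin 8) → List (Fin 8)
tokens (var zero)    r = 0F ∷ r
tokens (var (suc n)) r = tokens (var n) (1F ∷ r)
tokens bot           r = 2F ∷ r
tokens (φ ∧ ψ)       r = tokens φ (tokens ψ (3F ∷ r))
tokens (φ ∨ ψ)       r = tokens φ (tokens ψ (4F ∷ r))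
tokens (φ ⇒ ψ)       r = tokens φ (tokens ψ (5F ∷ r))
tokens (◇ φ)         r = tokens φ (6F ∷ r)
tokens (□ φ)         r = tokens φ (7F ∷ r)

-- A stack machine that inverts `tokens`; the last clause is a default for malformed input.
parse : List (Fin 8) → List Form → List Form
parse []       s           = s
parse (0F ∷ r) s           = parse r (var 0 ∷ s)
parse (1F ∷ r) (var n ∷ s) = parse r (var (suc n) ∷ s)
parse (2F ∷ r) s           = parse r (bot ∷ s)
parse (3F ∷ r) (ψ ∷ φ ∷ s) = parse r (φ ∧ ψ ∷ s)
parse (4F ∷ r) (ψ ∷ φ ∷ s) = parse r (φ ∨ ψ ∷ s)
parse (5F ∷ r) (ψ ∷ φ ∷ s) = parse r ((φ ⇒ ψ) ∷ s)
parse (6F ∷ r) (φ ∷ s)     = parse r (◇ φ ∷ s)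
parse (7F ∷ r) (φ ∷ s)     = parse r (□ φ ∷ s)
parse (_ ∷ _)  _           = []

parse-tokens : ∀ φ r s → parse (tokens φ r) s ≡ parse r (φ ∷ s)
parse-tokens (var zero)    r s = refl
parse-tokens (var (suc n)) r s = parse-tokens (var n) (1F ∷ r) s
parse-tokens bot           r s = refl
parse-tokens (φ ∧ ψ) r s = trans (parse-tokens φ _ s) (parse-tokens ψ _ (φ ∷ s))
parse-tokens (φ ∨ ψ) r s = trans (parse-tokens φ _ s) (parse-tokens ψ _ (φ ∷ s))
parse-tokens (φ ⇒ ψ) r s = trans (parse-tokens φ _ s) (parse-tokens ψ _ (φ ∷ s))
parse-tokens (◇ φ)   r s = parse-tokens φ _ s
parse-tokens (□ φ)   r s = parse-tokens φ _ s

tokens-injective : ∀ {φ ψ} → tokens φ [] ≡ tokens ψ [] → φ ≡ ψ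
tokens-injective {φ} {ψ} eq = ∷-injectiveˡ (trans (sym (parse-tokens φ [] []))
  (trans (cong (λ ts → parse ts []) eq) (parse-tokens ψ [] [])))

-- Bijective base 8: the digits stand for 1, …, 8, so trailing 0F's are not lost.
number : List (Fin 8) → ℕ
number []       = 0
number (d ∷ ds) = suc (toℕ d + number ds * 8)

number-injective : ∀ ds es → number ds ≡ number es → ds ≡ es
number-injective []       []       _  = refl
number-injective (d ∷ ds) (e ∷ es) eq = cong₂ _∷_ d≡e (number-injective ds es
    (*-cancelʳ-≡ _ _ 8 (+-cancelˡ-≡ (toℕ d) _ _
      (trans eq′ (cong (λ x → toℕ x + number es * 8) (sym d≡e))))))
  where
  eq′ : toℕ d + number ds * 8 ≡ toℕ e + number es * 8
  eq′ = suc-injective eq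
  last-digit : ∀ (c : Fin 8) n → (toℕ c + n * 8) % 8 ≡ toℕ c
  last-digit c n = trans ([m+kn]%n≡m%n (toℕ c) n 8) (m<n⇒m%n≡m (toℕ<n c))
  d≡e : d ≡ e
  d≡e = toℕ-injective (trans (sym (last-digit d (number ds)))
    (trans (cong (_% 8) eq′) (last-digit e (number es))))

-- Injectivity is what the Lindenbaum construction uses: stage `suc n` treats the at most one
-- formula with code `n`, and a number that codes nothing adds nothing.
encode : Form → ℕ
encode φ = number (tokens φ [])

encode-injective : ∀ {φ ψ} → encode φ ≡ encode ψ → φ ≡ ψ
encode-injective eq = tokens-injective (number-injective _ _ eq)

_≟ᶠ_ : DecidableEquality Form
φ ≟ᶠ ψ = map′ encode-injective (cong encode) (encode φ ≟ᴺ encode ψ)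

-- Subformulas, theories and prime theories

infix 4 _◁_

data _◁_ : Form → Form → Set where
  ∧ˡ : ∀ {φ ψ} → φ ◁ φ ∧ ψ
  ∧ʳ : ∀ {φ ψ} → ψ ◁ φ ∧ ψ
  ∨ˡ : ∀ {φ ψ} → φ ◁ φ ∨ ψ
  ∨ʳ : ∀ {φ ψ} → ψ ◁ φ ∨ ψ
  ⇒ˡ : ∀ {φ ψ} → φ ◁ φ ⇒ ψ
  ⇒ʳ : ∀ {φ ψ} → ψ ◁ φ ⇒ ψ
  ◇ᵃ : ∀ {φ} → φ ◁ ◇ φ
  □ᵃ : ∀ {φ} → φ ◁ □ φ

pattern h₀ = hyp (here refl)
pattern h₁ = hyp (there (here refl))
pattern h₂ = hyp (there (there (here refl)))
pattern h₃ = hyp (there (there (there (here refl))))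
pattern h₄ = hyp (there (there (there (there (here refl)))))
pattern h₅ = hyp (there (there (there (there (there (here refl))))))

⊤′ : Form
⊤′ = bot ⇒ bot

record IsTheory (T : Form → Set) : Set where
  field
    thm : ∀ {φ} → GS4⊢ φ → T φ
    mp  : ∀ {φ ψ} → T (φ ⇒ ψ) → T φ → T ψ

  infer : ∀ {Γ φ} → All T Γ → Γ ⊢ᴵ φ → T φ
  infer []       d = thm (taut d)
  infer (t ∷ ts) d = mp (infer ts (⇒I d)) t

  □-mp : ∀ {φ ψ} → T (□ (φ ⇒ ψ)) → T (□ φ) → T (□ ψ)
  □-mp t u = mp (mp (thm (K□ _ _)) t) u

  □-mono : ∀ {φ ψ} → GS4⊢ (φ ⇒ ψ) → T (□ φ) → T (□ ψ)
  □-mono d = □-mp (thm (Nec d))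

  □-infer₂ : ∀ {φ ψ χ} → φ ∷ ψ ∷ [] ⊢ᴵ χ → T (□ φ) → T (□ ψ) → T (□ χ)
  □-infer₂ d t u = □-mp (□-mono (taut (⇒I (⇒I d))) u) t

  ◇-mp : ∀ {φ ψ} → T (□ (φ ⇒ ψ)) → T (◇ φ) → T (◇ ψ)
  ◇-mp t u = mp (mp (thm (K◇ _ _)) t) u

open IsTheory

GS4-isTheory : IsTheory GS4⊢_
GS4-isTheory = record { thm = id ; mp = MP }

◇-mono : ∀ {φ ψ} → φ ∷ [] ⊢ᴵ ψ → GS4⊢ (◇ φ ⇒ ◇ ψ)
◇-mono d = MP (K◇ _ _) (Nec (taut (⇒I d)))

□-mono⇒ : ∀ {φ ψ} → φ ∷ [] ⊢ᴵ ψ → GS4⊢ (□ φ ⇒ □ ψ)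
□-mono⇒ d = MP (K□ _ _) (Nec (taut (⇒I d)))

-- Primeness and stability are phrased negatively so that prime theories can be
-- constructed without excluded middle.
record PrimeTheory : Set₁ where
  field
    ⟦_⟧        : Form → Set
    isTheory   : IsTheory ⟦_⟧
    stable     : ∀ {φ} → ¬ ¬ ⟦_⟧ φ → ⟦_⟧ φ
    prime      : ∀ {φ ψ} → ⟦_⟧ (φ ∨ ψ) → ¬ ⟦_⟧ φ → ¬ ⟦_⟧ ψ → ⊥
    consistent : ¬ ⟦_⟧ bot
  open IsTheory isTheory public

open PrimeTheory using (⟦_⟧)

-- Prime filter separation

module Lindenbaum
  (F I : Form → Set) (F-isTheory : IsTheory F)
  (I-∨ : ∀ {φ ψ} → I φ → I ψ → I (φ ∨ ψ))
  (disjoint : ∀ {φ} → F φ → ¬ I φ)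
  where

  -- Whether the formula `χ` with code `n` may be added is never decided: the condition that adding
  -- it avoids `I` is part of what membership by way of `χ` asserts.
  stage : ℕ → Form → Set
  stage zero    ψ = F ψ
  stage (suc n) ψ = stage n ψ ⊎
    ∃[ χ ] (encode χ ≡ n × (∀ ι → I ι → ¬ stage n (χ ⇒ ι)) × stage n (χ ⇒ ψ))

  stage-isTheory : ∀ n → IsTheory (stage n)
  stage-isTheory zero    = F-isTheory
  stage-isTheory (suc n) = record { thm = inj₁ ∘ thm S ; mp = stage-mp }
    where
    S : IsTheory (stage n)
    S = stage-isTheory n
    stage-mp : ∀ {φ ψ} → stage (suc n) (φ ⇒ ψ) → stage (suc n) φ → stage (suc n) ψ
    stage-mp (inj₁ t) (inj₁ u) = inj₁ (mp S t u)
    stage-mp (inj₁ t) (inj₂ (χ , e , c , u)) =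
      inj₂ (χ , e , c , infer S (t ∷ u ∷ []) (⇒I (⇒E h₁ (⇒E h₂ h₀))))
    stage-mp (inj₂ (χ , e , c , t)) (inj₁ u) =
      inj₂ (χ , e , c , infer S (t ∷ u ∷ []) (⇒I (⇒E (⇒E h₁ h₀) h₂)))
    -- Both added formulas have code `n`, hence coincide, and the two implications compose under one
    -- assumption.
    stage-mp (inj₂ (χ , e , c , t)) (inj₂ (χ′ , e′ , _ , u))
      with refl ← encode-injective {χ} {χ′} (trans e (sym e′)) =
      inj₂ (χ , e , c , infer S (t ∷ u ∷ []) (⇒I (⇒E (⇒E h₁ h₀) (⇒E h₂ h₀))))

  stage-disjoint : ∀ n {φ} → stage n φ → ¬ I φ
  stage-disjoint zero    t                    i = disjoint t i
  stage-disjoint (suc n) (inj₁ t)             i = stage-disjoint n t i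
  stage-disjoint (suc n) (inj₂ (_ , _ , c , t)) i = c _ i t

  stage-mono : ∀ {m n φ} → m ≤′ n → stage m φ → stage n φ
  stage-mono (≤′-reflexive refl) t = t
  stage-mono (≤′-step m≤n)       t = inj₁ (stage-mono m≤n t)

  limit : Form → Set
  limit φ = ∃[ n ] stage n φ

  limit-isTheory : IsTheory limit
  limit-isTheory = record
    { thm = λ d → zero , thm F-isTheory d
    ; mp  = λ { (m , t) (n , u) → m ⊔ n , mp (stage-isTheory (m ⊔ n))
        (stage-mono (≤⇒≤′ (m≤m⊔n m n)) t) (stage-mono (≤⇒≤′ (m≤n⊔m m n)) u) }
    }

  -- If adding `φ` avoided `I`, the stage that treats `φ` would have added it, because `φ ⇒ φ` is a
  -- theorem.
  limit-maximal : ∀ {φ} → ¬ limit φ → ¬ (∀ ι → I ι → ¬ limit (φ ⇒ ι))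
  limit-maximal {φ} ∉ c = ∉ (suc (encode φ) , inj₂ (φ , refl ,
    (λ ι i t → c ι i (encode φ , t)) , thm (stage-isTheory (encode φ)) (taut (⇒I h₀))))

  extension : ∃[ ι ] I ι → PrimeTheory
  extension (⊥ι , ⊥i) = record
    { ⟦_⟧        = λ φ → ¬ ¬ limit φ
    ; isTheory   = record
      { thm = λ d k → k (thm limit-isTheory d)
      ; mp  = λ t u k → t λ t′ → u λ u′ → k (mp limit-isTheory t′ u′)
      }
    ; stable     = λ t k → t λ t′ → t′ k
    -- If neither disjunct belongs, maximality makes each imply an element of `I`; the disjunction
    -- then yields a disjunction of two such elements, which is again in `I`.
    ; prime      = λ t ∉φ ∉ψ → t λ t′ →
        limit-maximal (λ l → ∉φ λ k → k l) λ ι i u →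
        limit-maximal (λ l → ∉ψ λ k → k l) λ κ j v →
        limit-disjoint (infer limit-isTheory (t′ ∷ u ∷ v ∷ [])
          (∨E h₀ (∨I₁ (⇒E h₂ h₀)) (∨I₂ (⇒E h₃ h₀)))) (I-∨ i j)
    ; consistent = λ t → t λ t′ → limit-disjoint (infer limit-isTheory (t′ ∷ []) (botE h₀)) ⊥i
    }
    where
    limit-disjoint : ∀ {φ} → limit φ → ¬ I φ
    limit-disjoint (n , t) = stage-disjoint n t

lindenbaum : ∀ (F I : Form → Set) → IsTheory F →
  (∀ {φ ψ} → I φ → I ψ → I (φ ∨ ψ)) → (∀ {φ} → F φ → ¬ I φ) → ∃[ ι ] I ι →
  Σ[ Γ ∈ PrimeTheory ] ((∀ {φ} → F φ → ⟦ Γ ⟧ φ) × (∀ {φ} → I φ → ¬ ⟦ Γ ⟧ φ))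
lindenbaum F I thy I-∨ disjoint inh = extension inh
  , (λ t k → k (0 , t))
  , (λ i t → t λ { (n , u) → stage-disjoint n u i })
  where open Lindenbaum F I thy I-∨ disjoint

-- Canonical relations and extensions of prime theories

infix 4 _⊆ᵀ_ _⊑ᵀ_

_⊆ᵀ_ : PrimeTheory → PrimeTheory → Set
Γ ⊆ᵀ Δ = ∀ {φ} → ⟦ Γ ⟧ φ → ⟦ Δ ⟧ φ

-- Intuitionistically `◇` is not definable from `□`, so each modality contributes its own condition.
record _⊑ᵀ_ (Γ Δ : PrimeTheory) : Set where
  field
    unbox : ∀ {φ} → ⟦ Γ ⟧ (□ φ) → ⟦ Δ ⟧ φ
    dia   : ∀ {φ} → ⟦ Δ ⟧ φ → ⟦ Γ ⟧ (◇ φ)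

open _⊑ᵀ_

module _ (Γ : PrimeTheory) where
  open PrimeTheory Γ using (stable; prime; consistent)
  private
    G : IsTheory ⟦ Γ ⟧
    G = PrimeTheory.isTheory Γ

  ⇒-total : ∀ φ ψ → ¬ ⟦ Γ ⟧ (φ ⇒ ψ) → ¬ ¬ ⟦ Γ ⟧ (ψ ⇒ φ)
  ⇒-total φ ψ = prime (thm G (extra (GD φ ψ)))

  -- The axiom FS is exactly what makes the filter generated by Γ and ◇Δ
  -- disjoint from the ideal generated by □σ, σ ∉ Δ.
  extend-source : ∀ Δ → (∀ {φ} → ⟦ Γ ⟧ (□ φ) → ⟦ Δ ⟧ φ) →
    Σ[ Γ′ ∈ PrimeTheory ] (Γ ⊆ᵀ Γ′ × Γ′ ⊑ᵀ Δ)
  extend-source Δ □Γ⊆Δ =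
    let Γ′ , F⊆ , I∩ = lindenbaum F I F-isTheory I-∨ disjoint
          (□ bot , bot , Δ.consistent , thm G (taut (⇒I h₀)))
    in Γ′
     , (λ t → F⊆ (⊤′ , ⊤∈Δ , infer G (t ∷ []) (⇒I h₁)))
     , record
       { unbox = λ t → Δ.stable λ ∉Δ → I∩ (_ , ∉Δ , thm G (taut (⇒I h₀))) t
       ; dia   = λ t → F⊆ (_ , t , thm G (taut (⇒I h₀)))
       }
    where
    module Δ = PrimeTheory Δ
    ⊤∈Δ : ⟦ Δ ⟧ ⊤′
    ⊤∈Δ = Δ.thm (taut (⇒I h₀))
    F I : Form → Set
    F χ = ∃[ δ ] (⟦ Δ ⟧ δ × ⟦ Γ ⟧ (◇ δ ⇒ χ))
    I χ = ∃[ σ ] (¬ ⟦ Δ ⟧ σ × ⟦ Γ ⟧ (χ ⇒ □ σ))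
    F-isTheory : IsTheory F
    F-isTheory = record
      { thm = λ d → ⊤′ , ⊤∈Δ , infer G (thm G d ∷ []) (⇒I h₁)
      ; mp  = λ { (δ , d , t) (δ′ , e , u) → δ ∧ δ′ , Δ.infer (d ∷ e ∷ []) (∧I h₀ h₁) ,
          infer G (t ∷ u ∷ thm G (◇-mono (∧E₁ h₀)) ∷ thm G (◇-mono (∧E₂ h₀)) ∷ [])
            (⇒I (⇒E (⇒E h₁ (⇒E h₃ h₀)) (⇒E h₂ (⇒E h₄ h₀)))) }
      }
    I-∨ : ∀ {φ ψ} → I φ → I ψ → I (φ ∨ ψ)
    I-∨ (σ , s , t) (ρ , r , u) = σ ∨ ρ , (λ v → Δ.prime v s r) ,
      infer G (t ∷ u ∷ thm G (□-mono⇒ (∨I₁ h₀)) ∷ thm G (□-mono⇒ (∨I₂ h₀)) ∷ [])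
        (⇒I (∨E h₀ (⇒E h₄ (⇒E h₂ h₀)) (⇒E h₅ (⇒E h₃ h₀))))
    disjoint : ∀ {φ} → F φ → ¬ I φ
    disjoint (δ , d , t) (σ , s , u) = s (Δ.mp (□Γ⊆Δ (mp G (thm G (extra (FS δ σ)))
      (infer G (t ∷ u ∷ []) (⇒I (⇒E h₂ (⇒E h₁ h₀)))))) d)

  -- The formulas whose `◇` is outside `Γ` form an ideal: `DP` closes it under disjunction and `N`
  -- puts `bot` into it. By `K◇` it avoids what `E` yields under the boxes of `Γ`. A prime `E`
  -- serves forward confluence, the consequences of one formula serve `◇-witness`.
  extend-target : ∀ (E : Form → Set) → IsTheory E → (∀ {φ} → E φ → ⟦ Γ ⟧ (◇ φ)) →
    Σ[ Δ ∈ PrimeTheory ] ((∀ {φ} → E φ → ⟦ Δ ⟧ φ) × Γ ⊑ᵀ Δ)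
  extend-target E E-isTheory E⊆◇Γ =
    let Δ , F⊆ , I∩ = lindenbaum F I F-isTheory I-∨ disjoint
          (bot , λ t → consistent (mp G (thm G (extra N)) t))
    in Δ
     , (λ e → F⊆ (_ , e , thm G (Nec (taut (⇒I h₀)))))
     , record
       { unbox = λ t → F⊆ (⊤′ , thm E-isTheory (taut (⇒I h₀)) , □-mono G (taut (⇒I (⇒I h₁))) t)
       ; dia   = λ t → stable λ ∉Γ → I∩ ∉Γ t
       }
    where
    F I : Form → Set
    F χ = ∃[ δ ] (E δ × ⟦ Γ ⟧ (□ (δ ⇒ χ)))
    I χ = ¬ ⟦ Γ ⟧ (◇ χ)
    F-isTheory : IsTheory F
    F-isTheory = record
      { thm = λ d → ⊤′ , thm E-isTheory (taut (⇒I h₀))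
          , thm G (Nec (infer GS4-isTheory (d ∷ []) (⇒I h₁)))
      ; mp  = λ { (δ , d , t) (δ′ , e , u) → δ ∧ δ′ , infer E-isTheory (d ∷ e ∷ []) (∧I h₀ h₁) ,
          □-infer₂ G (⇒I (⇒E (⇒E h₁ (∧E₁ h₀)) (⇒E h₂ (∧E₂ h₀)))) t u }
      }
    I-∨ : ∀ {φ ψ} → I φ → I ψ → I (φ ∨ ψ)
    I-∨ i j t = prime (mp G (thm G (extra (DP _ _))) t) i j
    disjoint : ∀ {φ} → F φ → ¬ I φ
    disjoint (δ , d , t) i = i (◇-mp G t (E⊆◇Γ d))

  ◇-witness : ∀ {φ} → ⟦ Γ ⟧ (◇ φ) → Σ[ Δ ∈ PrimeTheory ] (Γ ⊑ᵀ Δ × ⟦ Δ ⟧ φ)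
  ◇-witness {φ} t =
    let Δ , E⊆Δ , Γ⊑Δ = extend-target (λ χ → GS4⊢ (φ ⇒ χ)) record
          { thm = λ d → infer GS4-isTheory (d ∷ []) (⇒I h₁)
          ; mp  = λ d e → infer GS4-isTheory (d ∷ e ∷ []) (⇒I (⇒E (⇒E h₁ h₀) (⇒E h₂ h₀)))
          } (λ d → ◇-mp G (thm G (Nec d)) t)
    in Δ , Γ⊑Δ , E⊆Δ (taut (⇒I h₀))

  -- Separation gives a `Δ` that contains everything boxed in `Γ` and omits `φ`, but `◇Δ` need not
  -- lie in `Γ`. `extend-source` repairs this by enlarging `Γ`, which the clause for `□` permits
  -- since it first climbs along `≼`.
  □-counterexample : ∀ {φ} → ¬ ⟦ Γ ⟧ (□ φ) →
    Σ[ Γ′ ∈ PrimeTheory ] Σ[ Δ ∈ PrimeTheory ] (Γ ⊆ᵀ Γ′ × Γ′ ⊑ᵀ Δ × ¬ ⟦ Δ ⟧ φ)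
  □-counterexample {φ} ∉Γ =
    let Δ , F⊆ , I∩ = lindenbaum (λ χ → ⟦ Γ ⟧ (□ χ)) (λ χ → GS4⊢ (χ ⇒ φ))
          record { thm = thm G ∘ Nec ; mp = □-mp G }
          (λ d e → infer GS4-isTheory (d ∷ e ∷ []) (⇒I (∨E h₀ (⇒E h₂ h₀) (⇒E h₃ h₀))))
          (λ t d → ∉Γ (□-mono G d t))
          (φ , taut (⇒I h₀))
        Γ′ , Γ⊆Γ′ , Γ′⊑Δ = extend-source Δ F⊆
    in Γ′ , Δ , Γ⊆Γ′ , Γ′⊑Δ , I∩ (taut (⇒I h₀))

  ⇒-counterexample : ∀ {φ ψ} → ¬ ⟦ Γ ⟧ (φ ⇒ ψ) →
    Σ[ Γ′ ∈ PrimeTheory ] (Γ ⊆ᵀ Γ′ × ⟦ Γ′ ⟧ φ × ¬ ⟦ Γ′ ⟧ ψ)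
  ⇒-counterexample {φ} {ψ} ∉Γ =
    let Γ′ , F⊆ , I∩ = lindenbaum (λ χ → ⟦ Γ ⟧ (φ ⇒ χ)) (λ χ → ⟦ Γ ⟧ (χ ⇒ ψ))
          record
            { thm = λ d → infer G (thm G d ∷ []) (⇒I h₁)
            ; mp  = λ d e → infer G (d ∷ e ∷ []) (⇒I (⇒E (⇒E h₁ h₀) (⇒E h₂ h₀))) }
          (λ d e → infer G (d ∷ e ∷ []) (⇒I (∨E h₀ (⇒E h₂ h₀) (⇒E h₃ h₀))))
          (λ t u → ∉Γ (infer G (t ∷ u ∷ []) (⇒I (⇒E h₂ (⇒E h₁ h₀)))))
          (ψ , thm G (taut (⇒I h₀)))
    in Γ′ , (λ t → F⊆ (infer G (t ∷ []) (⇒I h₁)))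
     , F⊆ (thm G (taut (⇒I h₀))) , I∩ (thm G (taut (⇒I h₀)))

-- Finite sets and relations as numbers

infix 4 _∋_ _∋?_

-- A subset is an element of a finite type, so quantifiers over subsets are decided by `any?` and
-- `all?`.
_∋_ : ∀ {m} → Fin (2 ^ m) → Fin m → Set
s ∋ x = finToFun s x ≡ 1F

_∋?_ : ∀ {m} (s : Fin (2 ^ m)) (x : Fin m) → Dec (s ∋ x)
s ∋? x = finToFun s x ≟ 1F

¬¬-decide : ∀ {ℓ} n (P : Fin n → Set ℓ) → ¬ ¬ (∀ i → Dec (P i))
¬¬-decide zero    P k = k λ ()
¬¬-decide (suc n) P k = ¬¬-excluded-middle λ d₀ → ¬¬-decide n (P ∘ suc) λ d →
  k λ { zero → d₀ ; (suc i) → d i }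

-- `P` may live in any universe, for instance quantify over prime theories, while the set `s` is
-- small.
¬¬-comprehension : ∀ {ℓ} {m} (P : Fin m → Set ℓ) →
  ¬ ¬ (∃[ s ] (∀ x → (s ∋ x → P x) × (P x → s ∋ x)))
¬¬-comprehension P k = ¬¬-decide _ P λ P? →
  k (funToFin (indicator ∘ P?) , λ x →
    subst (λ b → (b ≡ 1F → P x) × (P x → b ≡ 1F))
      (sym (finToFun-funToFin (indicator ∘ P?) x)) (indicator-correct (P? x)))
  where
  indicator : ∀ {ℓ} {Q : Set ℓ} → Dec Q → Fin 2
  indicator (yes _) = 1F
  indicator (no _)  = 0F
  indicator-correct : ∀ {ℓ} {Q : Set ℓ} (d : Dec Q) →
    (indicator d ≡ 1F → Q) × (Q → indicator d ≡ 1F)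
  indicator-correct (yes q) = (λ _ → q) , (λ _ → refl)
  indicator-correct (no ¬q) = (λ ()) , (λ q → ⊥-elim (¬q q))

table : ∀ {m n} → Fin (2 ^ (m * n)) → Fin m → Fin n → Set
table s i j = s ∋ combine i j

table? : ∀ {m n} (s : Fin (2 ^ (m * n))) (i : Fin m) (j : Fin n) → Dec (table s i j)
table? s i j = s ∋? combine i j

¬¬-tabulate : ∀ {ℓ m n} (R : Fin m → Fin n → Set ℓ) →
  ¬ ¬ (∃[ s ] (∀ i j → (table s i j → R i j) × (R i j → table s i j)))
¬¬-tabulate {m = m} {n} R k = ¬¬-comprehension (uncurry R ∘ remQuot {m} n) λ (s , spec) →
  k (s , λ i j → subst (λ p → (table s i j → uncurry R p) × (uncurry R p → table s i j))
    (remQuot-combine i j) (spec (combine i j)))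

-- Codes of prime theories

module Filtration {k : ℕ} (φ : Fin k → Form)
  (⊤ᵢ : Fin k) (φ⊤ : φ ⊤ᵢ ≡ ⊤′) (⊥ᵢ : Fin k) (φ⊥ : φ ⊥ᵢ ≡ bot) where

  n : ℕ
  n = 2 ^ (k * k)

  entry : Fin n → Fin k → Fin k → Set
  entry = table

  -- The row of `⊤′` records membership, since `⊤′ ⇒ φ i` is equivalent to `φ i`.
  mem : Fin n → Fin k → Set
  mem τ i = entry τ ⊤ᵢ i

  -- The entries (i , j) with φ i ⇒ φ j ∈ Γ determine the whole chain of types
  -- of the prime theories above Γ, because Γ orders the formulas linearly.
  record Codes (Γ : PrimeTheory) (τ : Fin n) : Set where
    field
      read  : ∀ {i j} → entry τ i j → ⟦ Γ ⟧ (φ i ⇒ φ j)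
      write : ∀ {i j} → ⟦ Γ ⟧ (φ i ⇒ φ j) → entry τ i j

    readᵐ : ∀ {i} → mem τ i → ⟦ Γ ⟧ (φ i)
    readᵐ {i} t = PrimeTheory.mp Γ (subst (λ χ → ⟦ Γ ⟧ (χ ⇒ φ i)) φ⊤ (read t))
      (PrimeTheory.thm Γ (taut (⇒I h₀)))

    writeᵐ : ∀ {i} → ⟦ Γ ⟧ (φ i) → mem τ i
    writeᵐ t = write (PrimeTheory.infer Γ (t ∷ []) (⇒I h₁))

  open Codes

  ¬¬-code : ∀ Γ → ¬ ¬ (∃[ τ ] Codes Γ τ)
  ¬¬-code Γ c = ¬¬-tabulate (λ i j → ⟦ Γ ⟧ (φ i ⇒ φ j)) λ (τ , spec) →
    c (τ , record { read = proj₁ (spec _ _) ; write = proj₂ (spec _ _) })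

  -- τ′ arises from τ by making an up-set of the linear preorder τ true.
  infix 4 _≼ᶜ_

  record _≼ᶜ_ (τ τ′ : Fin n) : Set where
    field
      incl : ∀ {i j} → entry τ i j → entry τ′ i j
      cut  : ∀ {i j} → entry τ′ i j → entry τ i j ⊎ mem τ′ j

  open _≼ᶜ_

  ≼ᶜ-trans : ∀ {τ τ′ τ″} → τ ≼ᶜ τ′ → τ′ ≼ᶜ τ″ → τ ≼ᶜ τ″
  ≼ᶜ-trans p q = record
    { incl = incl q ∘ incl p
    ; cut  = λ e → [ (λ e′ → [ inj₁ , inj₂ ∘ incl q ]′ (cut p e′)) , inj₂ ]′ (cut q e)
    }

  -- In a linear Heyting algebra a ⇒ b is either ⊤ or b.
  new-⇒ : ∀ {Γ Γ′ a b} → Γ ⊆ᵀ Γ′ → ¬ ⟦ Γ ⟧ (a ⇒ b) → ⟦ Γ′ ⟧ (a ⇒ b) → ⟦ Γ′ ⟧ b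
  new-⇒ {Γ} {Γ′} {a} {b} Γ⊆Γ′ ∉Γ t = PrimeTheory.stable Γ′ λ ∉Γ′ →
    ⇒-total Γ a (a ⇒ b)
      (λ u → ∉Γ (PrimeTheory.infer Γ (u ∷ []) (⇒I (⇒E (⇒E h₁ h₀) h₀))))
      (λ u → ∉Γ′ (PrimeTheory.infer Γ′ (t ∷ Γ⊆Γ′ u ∷ []) (⇒E h₀ (⇒E h₁ h₀))))

  ⊆⇒≼ᶜ : ∀ {Γ Γ′ τ τ′} → Γ ⊆ᵀ Γ′ → Codes Γ τ → Codes Γ′ τ′ → τ ≼ᶜ τ′
  ⊆⇒≼ᶜ {Γ} {Γ′} {τ} {τ′} Γ⊆Γ′ c c′ = record
    { incl = λ e → write c′ (Γ⊆Γ′ (read c e))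
    ; cut  = λ {i} {j} e → case table? τ i j of λ where
        (yes e′) → inj₁ e′
        (no ∉τ)  → inj₂ (writeᵐ c′ (new-⇒ {Γ} {Γ′} Γ⊆Γ′ (∉τ ∘ write c) (read c′ e)))
    }

  -- Above a fixed `τ` a code is determined by its members: an entry beyond `τ` has a true
  -- consequent.
  ≼ᶜ-compare : ∀ {τ τ₁ τ₂ Γ₂} → Codes Γ₂ τ₂ → τ ≼ᶜ τ₁ → τ ≼ᶜ τ₂ →
    (∀ i → mem τ₁ i → mem τ₂ i) → τ₁ ≼ᶜ τ₂
  ≼ᶜ-compare {Γ₂ = Γ₂} c p q t⊆ = record
    { incl = λ e → [ incl q , (λ m → write c (PrimeTheory.infer Γ₂
        (readᵐ c (t⊆ _ m) ∷ []) (⇒I h₁))) ]′ (cut p e)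
    ; cut  = λ e → [ inj₁ ∘ incl p , inj₂ ]′ (cut q e)
    }

  code-total : ∀ {Γ τ} → Codes Γ τ → ∀ i j → entry τ i j ⊎ entry τ j i
  code-total {Γ} {τ} c i j = case table? τ i j of λ where
    (yes e) → inj₁ e
    (no ∉τ) → inj₂ (write c (PrimeTheory.stable Γ (⇒-total Γ _ _ (∉τ ∘ write c))))

  -- Up-sets of a linear preorder are nested. If some member `i` of `τ₁` is missing from `τ₂`, no
  -- member `j` of `τ₂` can lie below `i`, so every such `j` lies above `i` and belongs to `τ₁`.
  ≼ᶜ-linear : ∀ {Γ Γ₁ Γ₂ τ τ₁ τ₂} → Codes Γ τ → Codes Γ₁ τ₁ → Codes Γ₂ τ₂ →
    τ ≼ᶜ τ₁ → τ ≼ᶜ τ₂ → τ₁ ≼ᶜ τ₂ ⊎ τ₂ ≼ᶜ τ₁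
  ≼ᶜ-linear {Γ} {Γ₁} {Γ₂} {τ} {τ₁} {τ₂} c c₁ c₂ p q
    with all? (λ i → table? τ₁ ⊤ᵢ i →-dec table? τ₂ ⊤ᵢ i)
  ... | yes t₁⊆t₂ = inj₁ (≼ᶜ-compare c₂ p q t₁⊆t₂)
  ... | no  t₁⊈t₂ = inj₂ (≼ᶜ-compare c₁ q p λ j m → decidable-stable (table? τ₁ ⊤ᵢ j) λ ∉τ₁ →
    t₁⊈t₂ λ i l → case code-total c i j of λ where
      (inj₁ e) → ⊥-elim (∉τ₁ (writeᵐ c₁ (PrimeTheory.mp Γ₁ (read c₁ (incl p e)) (readᵐ c₁ l))))
      (inj₂ e) → writeᵐ c₂ (PrimeTheory.mp Γ₂ (read c₂ (incl q e)) (readᵐ c₂ m)))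

  -- Separates the filter generated by `Γ` and the members of `τ′` from the ideal generated by the
  -- non-members. The realisation `Γ₀` shows that the members form a proper up-set containing `⊤′`;
  -- `Γ₀` itself need not extend `Γ`.
  lift : ∀ {Γ Γ₀ τ τ′} → Codes Γ τ → Codes Γ₀ τ′ → τ ≼ᶜ τ′ →
    Σ[ Γ′ ∈ PrimeTheory ] (Γ ⊆ᵀ Γ′ × Codes Γ′ τ′)
  lift {Γ} {Γ₀} {τ} {τ′} c c₀ p =
    let Γ′ , F⊆ , I∩ = lindenbaum F I F-isTheory I-∨ disjoint
          (φ ⊥ᵢ , ⊥ᵢ , ⊥∉ , thm G (taut (⇒I h₀)))
        Γ⊆Γ′ : Γ ⊆ᵀ Γ′
        Γ⊆Γ′ = λ t → F⊆ (⊤ᵢ , ⊤∈ , infer G (t ∷ []) (⇒I h₁))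
        t′⊆ : ∀ {i} → mem τ′ i → ⟦ Γ′ ⟧ (φ i)
        t′⊆ = λ m → F⊆ (_ , m , thm G (taut (⇒I h₀)))
        ∉⇒∉ : ∀ {i} → ¬ mem τ′ i → ¬ ⟦ Γ′ ⟧ (φ i)
        ∉⇒∉ = λ ∉τ′ → I∩ (_ , ∉τ′ , thm G (taut (⇒I h₀)))
    in Γ′ , Γ⊆Γ′ , record
      { read  = λ e → [ Γ⊆Γ′ ∘ read c
          , (λ m → PrimeTheory.infer Γ′ (t′⊆ m ∷ []) (⇒I h₁)) ]′ (cut p e)
      ; write = λ {i} {j} t → decidable-stable (table? τ′ i j) λ ∉τ′ →
          ∉⇒∉ (λ m → ∉τ′ (write c₀ (PrimeTheory.infer Γ₀ (readᵐ c₀ m ∷ []) (⇒I h₁))))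
            (new-⇒ {Γ} {Γ′} Γ⊆Γ′ (λ u → ∉τ′ (incl p (write c u))) t)
      }
    where
    G : IsTheory ⟦ Γ ⟧
    G = PrimeTheory.isTheory Γ
    ⊤∈ : mem τ′ ⊤ᵢ
    ⊤∈ = writeᵐ c₀ (subst ⟦ Γ₀ ⟧ (sym φ⊤) (PrimeTheory.thm Γ₀ (taut (⇒I h₀))))
    ⊥∉ : ¬ mem τ′ ⊥ᵢ
    ⊥∉ m = PrimeTheory.consistent Γ₀ (subst ⟦ Γ₀ ⟧ φ⊥ (readᵐ c₀ m))
    -- A single generator suffices: of two members the lower implies both, and two non-members both
    -- imply the higher.
    F I : Form → Set
    F χ = ∃[ i ] (mem τ′ i × ⟦ Γ ⟧ (φ i ⇒ χ))
    I χ = ∃[ j ] (¬ mem τ′ j × ⟦ Γ ⟧ (χ ⇒ φ j))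
    F-isTheory : IsTheory F
    F-isTheory = record
      { thm = λ d → ⊤ᵢ , ⊤∈ , infer G (thm G d ∷ []) (⇒I h₁)
      ; mp  = λ { (i , l , t) (j , m , u) → case code-total c i j of λ where
          (inj₁ e) → i , l , infer G (t ∷ u ∷ read c e ∷ []) (⇒I (⇒E (⇒E h₁ h₀) (⇒E h₂ (⇒E h₃ h₀))))
          (inj₂ e) → j , m , infer G (t ∷ u ∷ read c e ∷ []) (⇒I (⇒E (⇒E h₁ (⇒E h₃ h₀)) (⇒E h₂ h₀))) }
      }
    I-∨ : ∀ {χ ψ} → I χ → I ψ → I (χ ∨ ψ)
    I-∨ (i , l , t) (j , m , u) = case code-total c i j of λ where
      (inj₁ e) → j , m , infer G (t ∷ u ∷ read c e ∷ []) (⇒I (∨E h₀ (⇒E h₄ (⇒E h₂ h₀)) (⇒E h₃ h₀)))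
      (inj₂ e) → i , l , infer G (t ∷ u ∷ read c e ∷ []) (⇒I (∨E h₀ (⇒E h₂ h₀) (⇒E h₄ (⇒E h₃ h₀))))
    disjoint : ∀ {χ} → F χ → ¬ I χ
    disjoint (i , l , t) (j , m , u) = m (writeᵐ c₀ (PrimeTheory.mp Γ₀
      (read c₀ (incl p (write c (infer G (t ∷ u ∷ []) (⇒I (⇒E h₂ (⇒E h₁ h₀))))))) (readᵐ c₀ l)))

  -- Relations on codes and their confluence

  Realised : Fin n → Set₁
  Realised τ = Σ[ Γ ∈ PrimeTheory ] Codes Γ τ

  -- Codes without a realisation are kept as isolated worlds.
  Up : Fin n → Fin n → Set₁
  Up τ τ′ = τ ≡ τ′ ⊎ (Realised τ × Realised τ′ × τ ≼ᶜ τ′)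

  -- Consecutive steps may realise the code between them by different theories, so steps need not
  -- compose; hence the closure `Star Step`.
  Step : Fin n → Fin n → Set₁
  Step τ σ = Σ[ Γ ∈ PrimeTheory ] Σ[ Δ ∈ PrimeTheory ] (Codes Γ τ × Codes Δ σ × Γ ⊑ᵀ Δ)

  ⊆⇒Up : ∀ {Γ Γ′ τ τ′} → Γ ⊆ᵀ Γ′ → Codes Γ τ → Codes Γ′ τ′ → Up τ τ′
  ⊆⇒Up {Γ} {Γ′} Γ⊆Γ′ c c′ = inj₂ ((Γ , c) , (Γ′ , c′) , ⊆⇒≼ᶜ Γ⊆Γ′ c c′)

  Up-trans : ∀ {τ τ′ τ″} → Up τ τ′ → Up τ′ τ″ → Up τ τ″
  Up-trans (inj₁ refl)        q                    = q
  Up-trans p@(inj₂ _)         (inj₁ refl)          = p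
  Up-trans (inj₂ (r , _ , p)) (inj₂ (_ , r″ , q)) = inj₂ (r , r″ , ≼ᶜ-trans p q)

  Up-linear : ∀ {τ τ₁ τ₂} → Up τ τ₁ → Up τ τ₂ → Up τ₁ τ₂ ⊎ Up τ₂ τ₁
  Up-linear (inj₁ refl) q           = inj₁ q
  Up-linear p@(inj₂ _)  (inj₁ refl) = inj₂ p
  Up-linear (inj₂ ((_ , c) , r₁@(_ , c₁) , p)) (inj₂ (_ , r₂@(_ , c₂) , q)) =
    [ (λ s → inj₁ (inj₂ (r₁ , r₂ , s))) , (λ s → inj₂ (inj₂ (r₂ , r₁ , s))) ]′
      (≼ᶜ-linear c c₁ c₂ p q)

  Up-mem : ∀ {τ τ′ i} → Up τ τ′ → mem τ i → mem τ′ i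
  Up-mem (inj₁ refl)        m = m
  Up-mem (inj₂ (_ , _ , p)) m = incl p m

  -- The step starts at a particular `Γ`, whereas only the code `τ′` is given above it. `lift`
  -- realises `τ′` by an extension of this very `Γ`, and canonical confluence then applies.
  forward : ∀ {τ τ′ σ} → Up τ τ′ → Star Step τ σ →
    ¬ ¬ (∃[ σ′ ] (Up σ σ′ × Star Step τ′ σ′))
  forward (inj₁ refl) xs k = k (_ , inj₁ refl , xs)
  forward p@(inj₂ _)  ε  k = k (_ , p , ε)
  forward (inj₂ (_ , (_ , c′) , p)) ((Γ , Δ , c , d , r) ◅ xs) k =
    let Γ′ , Γ⊆Γ′ , e = lift c c′ p
        Δ′ , Δ⊆Δ′ , r′ = extend-target Γ′ ⟦ Δ ⟧ (PrimeTheory.isTheory Δ) (Γ⊆Γ′ ∘ dia r)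
    in ¬¬-code Δ′ λ (ρ′ , d′) →
       forward (⊆⇒Up {Δ} {Δ′} Δ⊆Δ′ d d′) xs λ (σ′ , q , ys) →
       k (σ′ , q , (Γ′ , Δ′ , e , d′ , r′) ◅ ys)

  -- The tail of the chain is treated first; the code it returns is lifted above `Δ`, and
  -- `extend-source` supplies the new source.
  backward : ∀ {τ σ σ′} → Star Step τ σ → Up σ σ′ →
    ¬ ¬ (∃[ τ′ ] (Up τ τ′ × Star Step τ′ σ′))
  backward ε        q k = k (_ , q , ε)
  backward (x@(Γ , Δ , c , d , r) ◅ xs) q k = backward xs q λ where
    (ρ′ , inj₁ refl , ys) → k (_ , inj₁ refl , x ◅ ys)
    (ρ′ , inj₂ (_ , (_ , d₀) , p) , ys) →
      let Δ′ , Δ⊆Δ′ , d′ = lift d d₀ p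
          Γ′ , Γ⊆Γ′ , r′ = extend-source Γ Δ′ (Δ⊆Δ′ ∘ unbox r)
      in ¬¬-code Γ′ λ (τ′ , c′) →
         k (τ′ , ⊆⇒Up {Γ} {Γ′} Γ⊆Γ′ c c′ , (Γ′ , Δ′ , c′ , d′ , r′) ◅ ys)

  -- Modal formulas along chains of steps

  transfer : ∀ {Γ Δ τ ψ i} → φ i ≡ ψ → Codes Γ τ → Codes Δ τ → ⟦ Γ ⟧ ψ → ⟦ Δ ⟧ ψ
  transfer refl c d t = readᵐ d (writeᵐ c t)

  Up-preserves : ∀ {Γ τ τ′ ψ i} → φ i ≡ ψ → Codes Γ τ → Up τ τ′ → ⟦ Γ ⟧ ψ →
    Σ[ Γ′ ∈ PrimeTheory ] (Codes Γ′ τ′ × ⟦ Γ′ ⟧ ψ)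
  Up-preserves {Γ} eq   c (inj₁ refl)                t = Γ , c , t
  Up-preserves     refl c (inj₂ (_ , (Γ′ , c′) , p)) t = Γ′ , c′ , readᵐ c′ (incl p (writeᵐ c t))

  Star-realised : ∀ {τ σ} → Realised τ → Star Step τ σ → Realised σ
  Star-realised r ε                         = r
  Star-realised r ((_ , Δ , _ , d , _) ◅ xs) = Star-realised (Δ , d) xs

  -- The boxed formula itself is among the `φ i`, so it survives a change of realisation, and `4□`
  -- carries it across a step. `Star-◇` uses `4◇` in the opposite direction.
  Star-□ : ∀ {Γ τ σ χ i} → φ i ≡ □ χ → Codes Γ τ → Star Step τ σ → ⟦ Γ ⟧ (□ χ) →
    Σ[ Δ ∈ PrimeTheory ] (Codes Δ σ × ⟦ Δ ⟧ (□ χ))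
  Star-□ {Γ} eq c ε t = Γ , c , t
  Star-□ {Γ} eq c ((Γ₁ , Δ₁ , c₁ , d₁ , r) ◅ xs) t = Star-□ eq d₁ xs
    (unbox r (PrimeTheory.mp Γ₁ (PrimeTheory.thm Γ₁ (4□ _)) (transfer {Γ} {Γ₁} eq c c₁ t)))

  Star-◇ : ∀ {Γ Δ τ σ χ i} → φ i ≡ ◇ χ → Codes Γ τ → Codes Δ σ → Star Step τ σ →
    ⟦ Δ ⟧ (◇ χ) → ⟦ Γ ⟧ (◇ χ)
  Star-◇ {Γ} {Δ} eq c d ε t = transfer {Δ} {Γ} eq d c t
  Star-◇ {Γ} eq c d ((Γ₁ , Δ₁ , c₁ , d₁ , r) ◅ xs) t = transfer {Γ₁} {Γ} eq c₁ c
    (PrimeTheory.mp Γ₁ (PrimeTheory.thm Γ₁ (4◇ _)) (dia r (Star-◇ eq d₁ d xs t)))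

  -- Finite models and exhaustive search

  record IsFrame (A B : Fin n → Fin n → Set) : Set where
    field
      A-refl   : ∀ τ → A τ τ
      A-trans  : ∀ ρ σ τ → A ρ σ → A σ τ → A ρ τ
      B-refl   : ∀ τ → B τ τ
      B-trans  : ∀ ρ σ τ → B ρ σ → B σ τ → B ρ τ
      linear   : ∀ ρ σ τ → A ρ σ → A ρ τ → A σ τ ⊎ A τ σ
      confl    : ∀ τ τ′ σ → A τ τ′ → B τ σ → ∃[ σ′ ] (A σ σ′ × B τ′ σ′)
      confl⁻   : ∀ τ σ σ′ → B τ σ → A σ σ′ → ∃[ τ′ ] (A τ τ′ × B τ′ σ′)
      persists : ∀ τ τ′ i → A τ τ′ → mem τ i → mem τ′ i

  isFrame? : ∀ {A B} → (∀ σ τ → Dec (A σ τ)) → (∀ σ τ → Dec (B σ τ)) → Dec (IsFrame A B)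
  isFrame? A? B? = map′
    (λ (a , b , c , d , e , f , g , h) → record
      { A-refl = a ; A-trans = b ; B-refl = c ; B-trans = d
      ; linear = e ; confl = f ; confl⁻ = g ; persists = h })
    (λ F → let open IsFrame F in
      A-refl , A-trans , B-refl , B-trans , linear , confl , confl⁻ , persists)
    (refl? A? ×-dec trans? A? ×-dec refl? B? ×-dec trans? B?
    ×-dec all? (λ ρ → all? λ σ → all? λ τ → A? ρ σ →-dec A? ρ τ →-dec (A? σ τ ⊎-dec A? τ σ))
    ×-dec all? (λ τ → all? λ τ′ → all? λ σ → A? τ τ′ →-dec B? τ σ →-dec
      any? λ σ′ → A? σ σ′ ×-dec B? τ′ σ′)
    ×-dec all? (λ τ → all? λ σ → all? λ σ′ → B? τ σ →-dec A? σ σ′ →-dec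
      any? λ τ′ → A? τ τ′ ×-dec B? τ′ σ′)
    ×-dec all? (λ τ → all? λ τ′ → all? λ i → A? τ τ′ →-dec table? τ ⊤ᵢ i →-dec table? τ′ ⊤ᵢ i))
    where
    refl? : ∀ {R : Fin n → Fin n → Set} → (∀ σ τ → Dec (R σ τ)) → Dec (∀ τ → R τ τ)
    refl? R? = all? λ τ → R? τ τ
    trans? : ∀ {R : Fin n → Fin n → Set} → (∀ σ τ → Dec (R σ τ)) →
      Dec (∀ ρ σ τ → R ρ σ → R σ τ → R ρ τ)
    trans? R? = all? λ ρ → all? λ σ → all? λ τ → R? ρ σ →-dec R? σ τ →-dec R? ρ τ

  module _ (a b : Fin (2 ^ (n * n))) (F : IsFrame (table a) (table b)) where
    open IsFrame F

    model : Model
    model = record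
      { frame = record
        { W            = Fin n
        ; W⊥           = λ _ → ⊥
        ; _≼_          = table a
        ; _⊑_          = table b
        ; ≼-isPreorder = record
          { isEquivalence = isEquivalence
          ; reflexive = λ { refl → A-refl _ } ; trans = A-trans _ _ _ }
        ; ⊑-isPreorder = record
          { isEquivalence = isEquivalence
          ; reflexive = λ { refl → B-refl _ } ; trans = B-trans _ _ _ }
        ; W⊥-≼-closed  = λ _ ()
        ; W⊥-⊑-closed  = λ _ ()
        }
      -- A variable that is not among the `φ i` is false everywhere.
      ; V          = λ p τ → ∃[ i ] (φ i ≡ var p × mem τ i)
      ; V-≼-closed = λ p s (i , eq , m) → i , eq , persists _ _ i s m
      ; W⊥⊆V       = λ p ()
      }

    model-isGS4 : IsGS4Model model
    model-isGS4 = record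
      { infallible        = λ _ ()
      ; locallyLinear     = linear _ _ _
      ; forwardConfluent  = confl _ _ _
      ; backwardConfluent = confl⁻ _ _ _
      }

    sat? : ∀ ψ τ → Dec (model , τ ⊨ ψ)
    sat? (var p) τ = any? λ i → (φ i ≟ᶠ var p) ×-dec table? τ ⊤ᵢ i
    sat? bot     τ = no λ ()
    sat? (ψ ∧ χ) τ = sat? ψ τ ×-dec sat? χ τ
    sat? (ψ ∨ χ) τ = sat? ψ τ ⊎-dec sat? χ τ
    sat? (ψ ⇒ χ) τ = all? λ σ → table? a τ σ →-dec sat? ψ σ →-dec sat? χ σ
    sat? (◇ ψ)   τ = all? λ σ → table? a τ σ →-dec any? λ ρ → table? b σ ρ ×-dec sat? ψ ρ
    sat? (□ ψ)   τ = all? λ σ → all? λ ρ → table? a τ σ →-dec table? b σ ρ →-dec sat? ψ ρ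

  -- The model depends on the proof of `IsFrame`, and the one found by `frame?` may differ from the
  -- one supplied; hence a refutation is asked for every `F`.
  search : ∀ ψ →
    ¬ ¬ (∃[ a ] ∃[ b ] (IsFrame (table a) (table b) × ∀ F → ∃[ τ ] ¬ (model a b F , τ ⊨ ψ))) →
    ∃[ a ] ∃[ b ] ∃[ F ] ∃[ τ ] ¬ (model a b F , τ ⊨ ψ)
  search ψ ¬¬found = case any? (λ a → any? λ b → refuted? (frame? a b)) of λ where
      (yes (a , b , r)) → a , b , sound (frame? a b) r
      (no ¬found) → ⊥-elim (¬¬found λ (a , b , F , r) →
        ¬found (a , b , complete (frame? a b) F r))
    where
    frame? : ∀ a b → Dec (IsFrame (table a) (table b))
    frame? a b = isFrame? (table? a) (table? b)
    Refuted : ∀ {a b} → Dec (IsFrame (table a) (table b)) → Set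
    Refuted (yes F) = ∃[ τ ] ¬ (model _ _ F , τ ⊨ ψ)
    Refuted (no _)  = ⊥
    refuted? : ∀ {a b} (d : Dec (IsFrame (table a) (table b))) → Dec (Refuted d)
    refuted? (yes F) = any? λ τ → ¬? (sat? _ _ F ψ τ)
    refuted? (no _)  = no λ ()
    sound : ∀ {a b} (d : Dec (IsFrame (table a) (table b))) → Refuted d →
      ∃[ F ] ∃[ τ ] ¬ (model a b F , τ ⊨ ψ)
    sound (yes F) r = F , r
    complete : ∀ {a b} (d : Dec (IsFrame (table a) (table b))) → IsFrame (table a) (table b) →
      (∀ F → ∃[ τ ] ¬ (model a b F , τ ⊨ ψ)) → Refuted d
    complete (yes F) _ r = r F
    complete (no ¬F) F _ = ¬F F

  -- Truth lemma

  module Truth (closed : ∀ {ψ χ} → ψ ◁ χ → ∃[ i ] φ i ≡ χ → ∃[ j ] φ j ≡ ψ)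
    (a b : Fin (2 ^ (n * n)))
    (a⇔Up : ∀ τ σ → (table a τ σ → Up τ σ) × (Up τ σ → table a τ σ))
    (b⇔Star : ∀ τ σ → (table b τ σ → Star Step τ σ) × (Star Step τ σ → table b τ σ))
    where

    isFrame : IsFrame (table a) (table b)
    isFrame = record
      { A-refl   = λ _ → ↑a (inj₁ refl)
      ; A-trans  = λ _ _ _ p q → ↑a (Up-trans (↓a p) (↓a q))
      ; B-refl   = λ _ → ↑b ε
      ; B-trans  = λ _ _ _ p q → ↑b (↓b p ◅◅ ↓b q)
      ; linear   = λ _ _ _ p q → [ inj₁ ∘ ↑a , inj₂ ∘ ↑a ]′ (Up-linear (↓a p) (↓a q))
      ; confl    = λ _ τ′ σ p q →
          decidable-stable (any? λ σ′ → table? a σ σ′ ×-dec table? b τ′ σ′) λ k →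
          forward (↓a p) (↓b q) λ (σ′ , r , s) → k (σ′ , ↑a r , ↑b s)
      ; confl⁻   = λ τ _ σ′ p q →
          decidable-stable (any? λ τ′ → table? a τ τ′ ×-dec table? b τ′ σ′) λ k →
          backward (↓b p) (↓a q) λ (τ′ , r , s) → k (τ′ , ↑a r , ↑b s)
      ; persists = λ _ _ _ p → Up-mem (↓a p)
      }
      where
      ↓a : ∀ {τ σ} → table a τ σ → Up τ σ
      ↓a = proj₁ (a⇔Up _ _)
      ↑a : ∀ {τ σ} → Up τ σ → table a τ σ
      ↑a = proj₂ (a⇔Up _ _)
      ↓b : ∀ {τ σ} → table b τ σ → Star Step τ σ
      ↓b = proj₁ (b⇔Star _ _)
      ↑b : ∀ {τ σ} → Star Step τ σ → table b τ σ
      ↑b = proj₂ (b⇔Star _ _)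

    module _ (F : IsFrame (table a) (table b)) where
      private
        M : Model
        M = model a b F

      -- Stated for every realisation `Γ` of `τ`, because the relations lead to codes with
      -- realisations not chosen in advance.
      truth : ∀ ψ {i} → φ i ≡ ψ → ∀ {τ Γ} → Codes Γ τ →
        (M , τ ⊨ ψ → ⟦ Γ ⟧ ψ) × (⟦ Γ ⟧ ψ → M , τ ⊨ ψ)
      truth (var p) {i} eq {τ} {Γ} c =
          (λ (j , eq′ , m) → subst ⟦ Γ ⟧ eq′ (readᵐ c m))
        , (λ t → i , eq , writeᵐ c (subst ⟦ Γ ⟧ (sym eq) t))
      truth bot _ {τ} {Γ} c = (λ ()) , PrimeTheory.consistent Γ
      truth (ψ ∧ χ) eq {τ} {Γ} c =
        let to₁ , from₁ = truth ψ (proj₂ (closed ∧ˡ (_ , eq))) c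
            to₂ , from₂ = truth χ (proj₂ (closed ∧ʳ (_ , eq))) c
        in (λ (s , s′) → PrimeTheory.infer Γ (to₁ s ∷ to₂ s′ ∷ []) (∧I h₀ h₁))
         , (λ t → from₁ (PrimeTheory.infer Γ (t ∷ []) (∧E₁ h₀))
                , from₂ (PrimeTheory.infer Γ (t ∷ []) (∧E₂ h₀)))
      truth (ψ ∨ χ) eq {τ} {Γ} c =
        let to₁ , from₁ = truth ψ (proj₂ (closed ∨ˡ (_ , eq))) c
            to₂ , from₂ = truth χ (proj₂ (closed ∨ʳ (_ , eq))) c
        in [ (λ s → PrimeTheory.infer Γ (to₁ s ∷ []) (∨I₁ h₀))
           , (λ s → PrimeTheory.infer Γ (to₂ s ∷ []) (∨I₂ h₀)) ]′
         -- Primeness is only negative; decidability of satisfaction recovers the disjunction.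
         , (λ t → decidable-stable (sat? a b F (ψ ∨ χ) τ) λ k →
              PrimeTheory.prime Γ t (k ∘ inj₁ ∘ from₁) (k ∘ inj₂ ∘ from₂))
      truth (ψ ⇒ χ) eq {τ} {Γ} c = to , from
        where
        ih₁ : ∀ {τ Γ} → Codes Γ τ → (M , τ ⊨ ψ → ⟦ Γ ⟧ ψ) × (⟦ Γ ⟧ ψ → M , τ ⊨ ψ)
        ih₁ = truth ψ (proj₂ (closed ⇒ˡ (_ , eq)))
        ih₂ : ∀ {τ Γ} → Codes Γ τ → (M , τ ⊨ χ → ⟦ Γ ⟧ χ) × (⟦ Γ ⟧ χ → M , τ ⊨ χ)
        ih₂ = truth χ (proj₂ (closed ⇒ʳ (_ , eq)))
        to : M , τ ⊨ ψ ⇒ χ → ⟦ Γ ⟧ (ψ ⇒ χ)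
        to s = PrimeTheory.stable Γ λ ∉Γ →
          let Γ′ , Γ⊆Γ′ , t , ∉Γ′ = ⇒-counterexample Γ ∉Γ
          in ¬¬-code Γ′ λ (τ′ , c′) → ∉Γ′ (proj₁ (ih₂ c′)
               (s τ′ (proj₂ (a⇔Up _ _) (⊆⇒Up {Γ} {Γ′} Γ⊆Γ′ c c′)) (proj₂ (ih₁ c′) t)))
        from : ⟦ Γ ⟧ (ψ ⇒ χ) → M , τ ⊨ ψ ⇒ χ
        from t σ p s =
          let Γ′ , c′ , t′ = Up-preserves {Γ} eq c (proj₁ (a⇔Up _ _) p) t
          in proj₂ (ih₂ c′) (PrimeTheory.mp Γ′ t′ (proj₁ (ih₁ c′) s))
      truth (◇ ψ) eq {τ} {Γ} c = to , from
        where
        ih : ∀ {τ Γ} → Codes Γ τ → (M , τ ⊨ ψ → ⟦ Γ ⟧ ψ) × (⟦ Γ ⟧ ψ → M , τ ⊨ ψ)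
        ih = truth ψ (proj₂ (closed ◇ᵃ (_ , eq)))
        to : M , τ ⊨ ◇ ψ → ⟦ Γ ⟧ (◇ ψ)
        to s =
          -- Start at `τ` itself; `T◇` gives `◇ ψ` at the end of the chain, and `Star-◇` carries it
          -- back.
          let σ , q , s′ = s τ (proj₂ (a⇔Up _ _) (inj₁ refl))
              xs         = proj₁ (b⇔Star _ _) q
              Δ , d      = Star-realised (Γ , c) xs
          in Star-◇ eq c d xs (PrimeTheory.mp Δ (PrimeTheory.thm Δ (T◇ ψ)) (proj₁ (ih d) s′))
        from : ⟦ Γ ⟧ (◇ ψ) → M , τ ⊨ ◇ ψ
        from t σ p =
          decidable-stable (any? λ ρ → table? b σ ρ ×-dec sat? a b F ψ ρ) λ l →
            let Γ′ , c′ , t′ = Up-preserves {Γ} eq c (proj₁ (a⇔Up _ _) p) t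
                Δ , r , u    = ◇-witness Γ′ t′
            in ¬¬-code Δ λ (ρ , d) →
               l (ρ , proj₂ (b⇔Star _ _) ((Γ′ , Δ , c′ , d , r) ◅ ε) , proj₂ (ih d) u)
      truth (□ ψ) eq {τ} {Γ} c = to , from
        where
        ih : ∀ {τ Γ} → Codes Γ τ → (M , τ ⊨ ψ → ⟦ Γ ⟧ ψ) × (⟦ Γ ⟧ ψ → M , τ ⊨ ψ)
        ih = truth ψ (proj₂ (closed □ᵃ (_ , eq)))
        to : M , τ ⊨ □ ψ → ⟦ Γ ⟧ (□ ψ)
        to s = PrimeTheory.stable Γ λ ∉Γ →
          let Γ′ , Δ , Γ⊆Γ′ , r , ∉Δ = □-counterexample Γ ∉Γ
          in ¬¬-code Γ′ λ (τ′ , c′) → ¬¬-code Δ λ (σ , d) →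
             ∉Δ (proj₁ (ih d) (s τ′ σ (proj₂ (a⇔Up _ _) (⊆⇒Up {Γ} {Γ′} Γ⊆Γ′ c c′))
               (proj₂ (b⇔Star _ _) ((Γ′ , Δ , c′ , d , r) ◅ ε))))
        from : ⟦ Γ ⟧ (□ ψ) → M , τ ⊨ □ ψ
        from t σ ρ p q =
          let Γ′ , c′ , t′ = Up-preserves {Γ} eq c (proj₁ (a⇔Up _ _) p) t
              Δ , d , u    = Star-□ eq c′ (proj₁ (b⇔Star _ _) q) t′
          in proj₂ (ih d) (PrimeTheory.mp Δ (PrimeTheory.thm Δ (T□ ψ)) u)

  -- The tables and the code of `Γ` exist only up to double negation, so they are unpacked inside
  -- the doubly negated premise of `search`.
  countermodel : (∀ {ψ χ} → ψ ◁ χ → ∃[ i ] φ i ≡ χ → ∃[ j ] φ j ≡ ψ) →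
    ∀ {ψ i} → φ i ≡ ψ → ∀ Γ → ¬ ⟦ Γ ⟧ ψ →
    ∃[ a ] ∃[ b ] ∃[ F ] ∃[ τ ] ¬ (model a b F , τ ⊨ ψ)
  countermodel closed {ψ} eq Γ ∉Γ = search ψ λ k →
    ¬¬-tabulate Up λ (a , a⇔Up) →
    ¬¬-tabulate (Star Step) λ (b , b⇔Star) →
    ¬¬-code Γ λ (τ , c) →
    let open Truth closed a b a⇔Up b⇔Star
    in k (a , b , isFrame , λ F → τ , λ s → ∉Γ (proj₁ (truth F ψ eq c) s))

-- Subformula closure and the finite model property

subs : Form → List Form
subs (var p) = var p ∷ []
subs bot     = bot ∷ []
subs (φ ∧ ψ) = φ ∧ ψ ∷ subs φ ++ subs ψ
subs (φ ∨ ψ) = φ ∨ ψ ∷ subs φ ++ subs ψ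
subs (φ ⇒ ψ) = (φ ⇒ ψ) ∷ subs φ ++ subs ψ
subs (◇ φ)   = ◇ φ ∷ subs φ
subs (□ φ)   = □ φ ∷ subs φ

subs-refl : ∀ φ → φ ∈ subs φ
subs-refl (var p) = here refl
subs-refl bot     = here refl
subs-refl (φ ∧ ψ) = here refl
subs-refl (φ ∨ ψ) = here refl
subs-refl (φ ⇒ ψ) = here refl
subs-refl (◇ φ)   = here refl
subs-refl (□ φ)   = here refl

SubClosed : List Form → Set
SubClosed L = ∀ {ψ χ} → ψ ◁ χ → χ ∈ L → ψ ∈ L

∷-closed : ∀ {χ L} → (∀ {ψ} → ψ ◁ χ → ψ ∈ L) → SubClosed L → SubClosed (χ ∷ L)
∷-closed head tail s (here refl) = there (head s)
∷-closed head tail s (there m)   = there (tail s m)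

++-closed : ∀ {L K} → SubClosed L → SubClosed K → SubClosed (L ++ K)
++-closed {L} l r s m = [ ∈-++⁺ˡ ∘ l s , ∈-++⁺ʳ L ∘ r s ]′ (∈-++⁻ L m)

subs-closed : ∀ φ → SubClosed (subs φ)
subs-closed (var p) = ∷-closed (λ ()) (λ _ ())
subs-closed bot     = ∷-closed (λ ()) (λ _ ())
subs-closed (φ ∧ ψ) = ∷-closed
  (λ { ∧ˡ → ∈-++⁺ˡ (subs-refl φ) ; ∧ʳ → ∈-++⁺ʳ (subs φ) (subs-refl ψ) })
  (++-closed (subs-closed φ) (subs-closed ψ))
subs-closed (φ ∨ ψ) = ∷-closed
  (λ { ∨ˡ → ∈-++⁺ˡ (subs-refl φ) ; ∨ʳ → ∈-++⁺ʳ (subs φ) (subs-refl ψ) })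
  (++-closed (subs-closed φ) (subs-closed ψ))
subs-closed (φ ⇒ ψ) = ∷-closed
  (λ { ⇒ˡ → ∈-++⁺ˡ (subs-refl φ) ; ⇒ʳ → ∈-++⁺ʳ (subs φ) (subs-refl ψ) })
  (++-closed (subs-closed φ) (subs-closed ψ))
subs-closed (◇ φ)   = ∷-closed (λ { ◇ᵃ → subs-refl φ }) (subs-closed φ)
subs-closed (□ φ)   = ∷-closed (λ { □ᵃ → subs-refl φ }) (subs-closed φ)

mainTheorem2 : ∀ (φ : Form) → ¬ (GS4⊢ φ) → ∃[ M ] (IsGS4Model M × FinitelyManyWorlds M × M ⊭ φ)
mainTheorem2 φ ⊬φ =
  -- As `φ` is unprovable, the theorems avoid the formulas that imply `φ`, and separation gives a
  -- prime theory without `φ`.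
  let Γ , _ , I∩ = lindenbaum GS4⊢_ (λ χ → GS4⊢ (χ ⇒ φ)) GS4-isTheory
        (λ d e → infer GS4-isTheory (d ∷ e ∷ []) (⇒I (∨E h₀ (⇒E h₂ h₀) (⇒E h₃ h₀))))
        (λ t d → ⊬φ (MP d t)) (φ , taut (⇒I h₀))
      a , b , F , τ , ⊭φ = countermodel Σ-closed {i = index φ∈Σ} (sym (lookup-index φ∈Σ)) Γ
        (I∩ (taut (⇒I h₀)))
  in model a b F , model-isGS4 a b F , (n , ↔-id _) , λ ⊨φ → ⊭φ (⊨φ τ λ ())
  where
  Σ : List Form
  Σ = ⊤′ ∷ bot ∷ subs φ
  φ∈Σ : φ ∈ Σ
  φ∈Σ = there (there (subs-refl φ))
  Σ-closed : ∀ {ψ χ} → ψ ◁ χ → ∃[ i ] lookup Σ i ≡ χ → ∃[ j ] lookup Σ j ≡ ψ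
  Σ-closed s (i , refl) =
    let m = ∷-closed (λ { ⇒ˡ → here refl ; ⇒ʳ → here refl })
              (∷-closed (λ ()) (subs-closed φ)) s (∈-lookup i)
    in index m , sym (lookup-index m)
  open Filtration (lookup Σ) 0F refl 1F refl
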